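{- For every finite field $\mathbb{F}_q$, the unit-graph on $\operatorname{Mat}_2(\mathbb{F}_q)$ is a strongly regular graph with parameters $(q^4,\; q^4-q^3-q^2+q,\; q^4-2q^3-q^2+3q,\; q^4-2q^3+q)$.
   Context: The unit-graph on $\operatorname{Mat}_2(\mathbb{F}_q)$ is the graph with vertex set $\operatorname{Mat}_2(\mathbb{F}_q)$ in which $A$ and $B$ are adjacent iff $B - A \in \operatorname{GL}_2(\mathbb{F}_q)$. A non-empty, non-complete regular graph is strongly regular with parameters $(n,k,a,c)$ if it has $n$ vertices, is $k$-regular, every pair of distinct adjacent vertices has exactly $a$ common neighbours, and every pair of distinct nonadjacent vertices has exactly $c$ common neighbours. -}

module Defs where

open import Level using (Level; _⊔_; suc)
open import Data.Bool.Base using (if_then_else_)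
open import Data.Fin.Base using (Fin; zero)
open import Data.Fin.Properties using (_≟_)
open import Data.Nat.Base using (ℕ)
open import Data.Product.Base using (Σ; _×_; _,_; proj₁; proj₂)
open import Data.Vec.Functional using (Vector)
import Data.Vec.Functional.Relation.Binary.Pointwise.Properties as Pointwise
open import Function.Bundles using (Bijection)
open import Relation.Binary.Bundles using (Setoid)
open import Relation.Binary.Core using (Rel)
open import Relation.Binary.Definitions using (Symmetric; Irreflexive; _Respects₂_)
import Relation.Binary.Construct.On as On
import Relation.Binary.PropositionalEquality.Properties as ≡
open import Relation.Nullary.Decidable.Core using (does)
open import Relation.Nullary.Negation.Core using (¬_)
open import Algebra.Apartness.Bundles using (HeytingField; HeytingCommutativeRing)
open import Algebra.Bundles using (CommutativeRing)
import Algebra.Definitions as AlgebraDefinitions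
import Algebra.Properties.Ring as RingProperties
import Algebra.Properties.Semiring.Sum as SemiringSum

HasCardinality : ∀ {a ℓ} → Setoid a ℓ → ℕ → Set (a ⊔ ℓ)
HasCardinality S n = Bijection S (≡.setoid (Fin n))

-- Elements are compared by their first components only, so proofs of
-- membership do not contribute to the cardinality.
subsetoid : ∀ {a ℓ p} (S : Setoid a ℓ) → (Setoid.Carrier S → Set p) → Setoid (a ⊔ p) ℓ
subsetoid S P = On.setoid {B = Σ (Setoid.Carrier S) P} S proj₁

record SimpleGraph v ℓ e : Set (suc (v ⊔ ℓ ⊔ e)) where
  field
    vertexSetoid : Setoid v ℓ

  open Setoid vertexSetoid public
    using (_≈_; _≉_) renaming (Carrier to Vertex)

  field
    Adjacent : Rel Vertex e
    resp     : Adjacent Respects₂ _≈_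
    sym      : Symmetric Adjacent
    irrefl   : Irreflexive _≈_ Adjacent

  -- Empty in the sense of having no edges.
  Empty : Set (v ⊔ e)
  Empty = ∀ x y → ¬ Adjacent x y

  Complete : Set (v ⊔ ℓ ⊔ e)
  Complete = ∀ x y → x ≉ y → Adjacent x y

  neighbours : Vertex → Setoid (v ⊔ e) ℓ
  neighbours x = subsetoid vertexSetoid (Adjacent x)

  commonNeighbours : Vertex → Vertex → Setoid (v ⊔ e) ℓ
  commonNeighbours x y = subsetoid vertexSetoid λ z → Adjacent x z × Adjacent y z

record IsStronglyRegular {v ℓ e} (G : SimpleGraph v ℓ e) (n k a c : ℕ)
                         : Set (v ⊔ ℓ ⊔ e) where
  open SimpleGraph G
  field
    nonEmpty    : ¬ Empty
    nonComplete : ¬ Complete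
    order       : HasCardinality vertexSetoid n
    regular     : ∀ x → HasCardinality (neighbours x) k
    adjacent    : ∀ x y → x ≉ y → Adjacent x y → HasCardinality (commonNeighbours x y) a
    nonadjacent : ∀ x y → x ≉ y → ¬ Adjacent x y → HasCardinality (commonNeighbours x y) c

-- The apartness of a Heyting field is determined up to equivalence by the ring:
-- x # y holds exactly when x - y is invertible.  Irreflexivity then forces 1# ≉ 0#,
-- and when the carrier is finite (so that _≈_ is decidable and inverses can be
-- searched for), tightness makes _#_ coincide with _≉_; thus a finite Heyting field
-- is the same thing as a finite field.
module _ {c ℓ₁ ℓ₂} (F : HeytingField c ℓ₁ ℓ₂) where

  fieldRing : CommutativeRing c ℓ₁
  fieldRing = HeytingCommutativeRing.commutativeRing (HeytingField.heytingCommutativeRing F)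

  fieldSetoid : Setoid c ℓ₁
  fieldSetoid = CommutativeRing.setoid fieldRing

  private
    module R = CommutativeRing fieldRing
    module RP = RingProperties R.ring
  open SemiringSum R.semiring using (sum; sum-cong-≋; sum-replicate-zero)

  matSetoid : ℕ → Setoid c ℓ₁
  matSetoid n = Pointwise.setoid (Pointwise.setoid fieldSetoid n) n

  Mat : ℕ → Set c
  Mat n = Vector (Vector R.Carrier n) n

  infix  4 _≈ᴹ_
  infixl 6 _-ᴹ_
  infixl 7 _*ᴹ_

  _≈ᴹ_ : ∀ {n} → Rel (Mat n) ℓ₁
  _≈ᴹ_ {n} = Setoid._≈_ (matSetoid n)

  _-ᴹ_ : ∀ {n} → Mat n → Mat n → Mat n
  (A -ᴹ B) i j = A i j R.- B i j

  _*ᴹ_ : ∀ {n} → Mat n → Mat n → Mat n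
  (A *ᴹ B) i j = sum λ k → A i k R.* B k j

  1ᴹ : ∀ {n} → Mat n
  1ᴹ i j = if does (i ≟ j) then R.1# else R.0#

  GL : ∀ {n} → Mat n → Set (c ⊔ ℓ₁)
  GL {n} = AlgebraDefinitions.Invertible (_≈ᴹ_ {n}) 1ᴹ _*ᴹ_

  1≉0 : ¬ (R.1# R.≈ R.0#)
  1≉0 1≈0 = HeytingField.#-irrefl F R.refl
    (HeytingField.invertible⇒# F {R.0#} {R.0#} (R.0# , 0*≈1 _ , R.trans (R.*-comm _ _) (0*≈1 _)))
    where
    0*≈1 : ∀ x → (R.0# R.* x) R.≈ R.1#
    0*≈1 x = R.trans (R.zeroˡ x) (R.sym 1≈0)

  GL-resp : ∀ {n} {A B : Mat n} → A ≈ᴹ B → GL A → GL B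
  GL-resp A≈B (X , XA≈1 , AX≈1) = X
    , (λ i j → R.trans (sum-cong-≋ λ k → R.*-congˡ (R.sym (A≈B k j))) (XA≈1 i j))
    , (λ i j → R.trans (sum-cong-≋ λ k → R.*-congʳ (R.sym (A≈B i k))) (AX≈1 i j))

  -x*-y≈x*y : ∀ x y → ((R.- x) R.* (R.- y)) R.≈ (x R.* y)
  -x*-y≈x*y x y = R.trans (R.sym (RP.-‿distribˡ-* x (R.- y)))
    (R.trans (R.-‿cong (R.sym (RP.-‿distribʳ-* x y))) (RP.-‿involutive (x R.* y)))

  GL-neg : ∀ {n} {A : Mat n} → GL A → GL (λ i j → R.- A i j)
  GL-neg {n} {A} (X , XA≈1 , AX≈1) = (λ i j → R.- X i j)
    , (λ i j → R.trans (sum-cong-≋ {n} λ k → -x*-y≈x*y (X i k) (A k j)) (XA≈1 i j))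
    , (λ i j → R.trans (sum-cong-≋ {n} λ k → -x*-y≈x*y (A i k) (X k j)) (AX≈1 i j))

  ¬GL-0 : ∀ {n} {A : Mat (ℕ.suc n)} → (∀ i j → A i j R.≈ R.0#) → ¬ GL A
  ¬GL-0 {n} {A} A≈0 (X , _ , AX≈1) = 1≉0 (R.trans (R.sym (AX≈1 zero zero))
    (R.trans (sum-cong-≋ {ℕ.suc n} λ k → R.trans (R.*-congʳ (A≈0 zero k)) (R.zeroˡ (X k zero)))
             (sum-replicate-zero (ℕ.suc n))))

  -ᴹ-cong : ∀ {n} {A A′ B B′ : Mat n} → A ≈ᴹ A′ → B ≈ᴹ B′ → A -ᴹ B ≈ᴹ A′ -ᴹ B′
  -ᴹ-cong A≈A′ B≈B′ i j = R.+-cong (A≈A′ i j) (R.-‿cong (B≈B′ i j))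

  ≈ᴹ-refl : ∀ {n} (A : Mat n) → A ≈ᴹ A
  ≈ᴹ-refl A i j = R.refl

  unitGraph : SimpleGraph c ℓ₁ (c ⊔ ℓ₁)
  unitGraph = record
    { vertexSetoid = matSetoid 2
    ; Adjacent     = λ A B → GL (B -ᴹ A)
    ; resp         = (λ {A} B≈B′ → GL-resp (-ᴹ-cong B≈B′ (≈ᴹ-refl A)))
                   , (λ {B} A≈A′ → GL-resp (-ᴹ-cong (≈ᴹ-refl B) A≈A′))
    ; sym          = λ {A} {B} g → GL-resp (λ i j → RP.⁻¹-anti-homo‿- (B i j) (A i j)) (GL-neg {A = B -ᴹ A} g)
    ; irrefl       = λ {A} {B} A≈B → ¬GL-0 {A = B -ᴹ A} λ i j →
                       R.trans (R.+-congʳ (R.sym (A≈B i j))) (R.-‿inverseʳ (A i j))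
    }

{-# OPTIONS --safe #-}

-- After a translation by x the common neighbours of x and y are the Z with Z and
-- Z - D invertible, where D = y - x, so by inclusion-exclusion it suffices to count the
-- singular matrices (q³ + q² - q of them) and the Z with Z and Z - D both singular.
-- Every count reduces to that of the hyperbola b c = t, which has q - 1 points,
-- or 2 q - 1 if t = 0.  Row and column swaps put a nonzero entry e of
-- D = (e f; g h) in the corner.  Then Z = (a b; c d) and Z - D are both singular iff
-- (e b - f a) (e c - g a) = a (e - a) det D and d is the root of a linear equation:
-- for each a this is a hyperbola, degenerate for a ∈ {0, e} if det D ≠ 0 and for all
-- a if det D = 0.
module Submission where

open import Defs
open import Algebra.Apartness.Bundles using (HeytingField)
open import Data.Nat.Base using (ℕ; _+_; _*_; _∸_; _^_)

open import Algebra.Bundles using (CommutativeRing)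
import Algebra.Properties.CommutativeSemigroup as CommutativeSemigroupProperties
import Algebra.Properties.Monoid.Mult as MonoidMult
import Algebra.Properties.Ring as RingProperties
import Algebra.Properties.Semiring.Mult as SemiringMult
import Algebra.Properties.Semiring.Sum as SemiringSum
import Algebra.Solver.Ring as RingSolver
open import Algebra.Solver.Ring.AlmostCommutativeRing
  using (fromCommutativeRing; _-Raw-AlmostCommutative⟶_)
open import Data.Bool.Base using (true; false; if_then_else_)
open import Data.Fin.Base as Fin using (Fin; zero; suc)
open import Data.Fin.Patterns using (0F; 1F)
import Data.Fin.Properties as Fin
open import Data.Integer.Base as ℤ using (ℤ; +_; -[1+_]; _⊖_)
import Data.Integer.Properties as ℤ
open import Data.List.Base as List using (List; []; _∷_; length; lookup)
open import Data.List.Membership.Propositional.Properties using (∈-lookup)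
import Data.List.Membership.Setoid as Membership
open import Data.List.Membership.Setoid.Properties
  using (∈-resp-≈; ∈-tabulate⁺; ∈-cartesianProductWith⁺; ∈-cartesianProduct⁺; ∈-filter⁺)
import Data.List.Properties as List
open import Data.List.Relation.Unary.All as All using (All)
import Data.List.Relation.Unary.All.Properties as All
open import Data.List.Relation.Unary.AllPairs using (_∷_)
import Data.List.Relation.Unary.Any as Any
open import Data.List.Relation.Unary.Any.Properties using (lookup-index)
import Data.List.Relation.Unary.Unique.Setoid as UniqueSetoid
import Data.List.Relation.Unary.Unique.Setoid.Properties as Unique
import Data.Maybe.Base as Maybe
import Data.Nat.Base as ℕ
open import Data.Nat.ListAction using () renaming (sum to sumᴸ)
open import Data.Nat.ListAction.Properties using (sum-++)
import Data.Nat.Properties as ℕ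
open import Data.Nat.Tactic.RingSolver using (solve-∀)
open import Data.Product.Base using (Σ; _×_; _,_; proj₁; proj₂)
open import Data.Product.Relation.Binary.Pointwise.NonDependent using (_×ₛ_)
open import Data.Sum.Base using (_⊎_; inj₁; inj₂; [_,_])
open import Data.Unit.Base using (⊤; tt)
open import Function.Base using (_∘_; id)
open import Function.Bundles using (Bijection; Inverse; mk⇔)
import Function.Construct.Composition as Composition
open import Function.Definitions using (Bijective)
open import Function.Properties.Inverse using (Inverse⇒Bijection)
open import Level using (_⊔_)
open import Relation.Binary.Bundles using (Setoid)
open import Relation.Binary.Consequences using (dec⇒weaklyDec)
open import Relation.Binary.Definitions using (_Respects_)
open import Relation.Binary.PropositionalEquality as ≡ using (_≡_; _≢_; cong)
import Relation.Binary.Reasoning.Setoid as SetoidReasoning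
open import Relation.Nullary.Decidable
  using (Dec; yes; no; _because_; does; ¬?; _×-dec_; decidable-stable; dec-true; dec-false; does-⇔; map′)
open import Relation.Nullary.Negation using (¬_; contradiction)

open SemiringSum ℕ.+-*-semiring
  using (sum; sum-cong-≗; ∑-distrib-+; ∑-comm; *-distribˡ-sum; sum-replicate-zero)

-- Polynomial identities in commutative rings.

-- ℤ-coefficients, rather than coefficients in the ring itself, let the solver
-- cancel terms: equality of coefficients is then decidable by computation.
module ℤ-Solver {c ℓ} (R : CommutativeRing c ℓ) where
  open CommutativeRing R renaming (_+_ to _+ᴿ_; _*_ to _*ᴿ_)
  open RingProperties ring using (-0#≈0#; -‿+-comm; -‿distribˡ-*; -‿distribʳ-*; -‿involutive)
  open CommutativeSemigroupProperties (CommutativeRing.+-commutativeSemigroup R) using (interchange)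
  open SemiringMult semiring using (×1-homo-*)
  open MonoidMult +-monoid using (×-homo-+; ×-homo-1) renaming (_×_ to _·_)
  open SetoidReasoning setoid

  fromℤ : ℤ → Carrier
  fromℤ (+ n)    = n · 1#
  fromℤ -[1+ n ] = - (ℕ.suc n · 1#)

  -- Both sides are unchanged when `m` and `n` drop by one: on the right, `1# - 1#` is inserted and
  -- split between the two multiples.
  ⊖-homo : ∀ m n → fromℤ (m ⊖ n) ≈ m · 1# - n · 1#
  ⊖-homo m         ℕ.zero    = sym (trans (+-congˡ -0#≈0#) (+-identityʳ _))
  ⊖-homo ℕ.zero    (ℕ.suc n) = sym (+-identityˡ _)
  ⊖-homo (ℕ.suc m) (ℕ.suc n) = begin
    fromℤ (ℕ.suc m ⊖ ℕ.suc n)            ≡⟨ cong fromℤ (ℤ.[1+m]⊖[1+n]≡m⊖n m n) ⟩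
    fromℤ (m ⊖ n)                        ≈⟨ ⊖-homo m n ⟩
    m · 1# - n · 1#                      ≈⟨ +-identityˡ _ ⟨
    0# +ᴿ (m · 1# - n · 1#)              ≈⟨ +-congʳ (-‿inverseʳ 1#) ⟨
    (1# - 1#) +ᴿ (m · 1# - n · 1#)       ≈⟨ interchange _ _ _ _ ⟩
    ℕ.suc m · 1# +ᴿ (- 1# +ᴿ - (n · 1#)) ≈⟨ +-congˡ (-‿+-comm _ _) ⟩
    ℕ.suc m · 1# - ℕ.suc n · 1#          ∎

  +-homo : ∀ i j → fromℤ (i ℤ.+ j) ≈ fromℤ i +ᴿ fromℤ j
  +-homo (+ m)    (+ n)    = ×-homo-+ 1# m n
  +-homo (+ m)    -[1+ n ] = ⊖-homo m (ℕ.suc n)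
  +-homo -[1+ m ] (+ n)    = trans (⊖-homo n (ℕ.suc m)) (+-comm _ _)
  +-homo -[1+ m ] -[1+ n ] = begin
    - (ℕ.suc (ℕ.suc (m + n)) · 1#)         ≡⟨ cong (λ k → - (ℕ.suc k · 1#)) (ℕ.+-suc m n) ⟨
    - ((ℕ.suc m + ℕ.suc n) · 1#)           ≈⟨ -‿cong (×-homo-+ 1# (ℕ.suc m) (ℕ.suc n)) ⟩
    - (ℕ.suc m · 1# +ᴿ ℕ.suc n · 1#)       ≈⟨ -‿+-comm _ _ ⟨
    - (ℕ.suc m · 1#) +ᴿ - (ℕ.suc n · 1#)   ∎

  -‿homo : ∀ i → fromℤ (ℤ.- i) ≈ - fromℤ i
  -‿homo (+ ℕ.zero)  = sym -0#≈0#
  -‿homo (+ ℕ.suc n) = refl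
  -‿homo -[1+ n ]    = sym (-‿involutive _)

  *-homo-ℕ : ∀ m n → fromℤ (+ m ℤ.* + n) ≈ fromℤ (+ m) *ᴿ fromℤ (+ n)
  *-homo-ℕ m n = trans (reflexive (cong fromℤ (≡.sym (ℤ.pos-* m n)))) (×1-homo-* m n)

  *-homo-+ʳ : ∀ i n → fromℤ (i ℤ.* + n) ≈ fromℤ i *ᴿ fromℤ (+ n)
  *-homo-+ʳ (+ m)    n = *-homo-ℕ m n
  *-homo-+ʳ -[1+ m ] n = begin
    fromℤ (-[1+ m ] ℤ.* + n)           ≡⟨ cong fromℤ (ℤ.neg-distribˡ-* (+ ℕ.suc m) (+ n)) ⟨
    fromℤ (ℤ.- (+ ℕ.suc m ℤ.* + n))    ≈⟨ -‿homo (+ ℕ.suc m ℤ.* + n) ⟩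
    - fromℤ (+ ℕ.suc m ℤ.* + n)        ≈⟨ -‿cong (*-homo-ℕ (ℕ.suc m) n) ⟩
    - (ℕ.suc m · 1# *ᴿ n · 1#)         ≈⟨ -‿distribˡ-* _ _ ⟩
    fromℤ -[1+ m ] *ᴿ n · 1#           ∎

  *-homo : ∀ i j → fromℤ (i ℤ.* j) ≈ fromℤ i *ᴿ fromℤ j
  *-homo i (+ n)    = *-homo-+ʳ i n
  *-homo i -[1+ n ] = begin
    fromℤ (i ℤ.* -[1+ n ])           ≡⟨ cong fromℤ (ℤ.neg-distribʳ-* i (+ ℕ.suc n)) ⟨
    fromℤ (ℤ.- (i ℤ.* + ℕ.suc n))    ≈⟨ -‿homo (i ℤ.* + ℕ.suc n) ⟩
    - fromℤ (i ℤ.* + ℕ.suc n)        ≈⟨ -‿cong (*-homo-+ʳ i (ℕ.suc n)) ⟩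
    - (fromℤ i *ᴿ ℕ.suc n · 1#)      ≈⟨ -‿distribʳ-* _ _ ⟩
    fromℤ i *ᴿ fromℤ -[1+ n ]        ∎

  morphism : ℤ.+-*-rawRing -Raw-AlmostCommutative⟶ fromCommutativeRing R
  morphism = record
    { ⟦_⟧    = fromℤ
    ; +-homo = +-homo
    ; *-homo = *-homo
    ; -‿homo = -‿homo
    ; 0-homo = refl
    ; 1-homo = ×-homo-1 1#
    }

  open RingSolver ℤ.+-*-rawRing (fromCommutativeRing R) morphism
    (λ i j → Maybe.map (λ i≡j → reflexive (cong fromℤ i≡j)) (dec⇒weaklyDec ℤ._≟_ i j))
    public using (solve; _:=_; _:+_; _:*_; _:-_; :-_)

-- Cardinalities from enumerations, and their transport.

module _ {a ℓ} (S : Setoid a ℓ) where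
  open Setoid S
  open UniqueSetoid S using (Unique)

  lookup-injective : ∀ {xs} → Unique xs → ∀ i j → lookup xs i ≈ lookup xs j → i ≡ j
  lookup-injective (x∉ ∷ xs!) zero    zero    eq = ≡.refl
  lookup-injective (x∉ ∷ xs!) zero    (suc j) eq = contradiction eq (All.lookup x∉ (∈-lookup j))
  lookup-injective (x∉ ∷ xs!) (suc i) zero    eq = contradiction (sym eq) (All.lookup x∉ (∈-lookup i))
  lookup-injective (x∉ ∷ xs!) (suc i) (suc j) eq = cong suc (lookup-injective xs! i j eq)

  module _ {p} {P : Carrier → Set p} where
    open Membership S using (_∈_)

    -- An element goes to the position at which `complete` finds it. This position could vary with
    -- the proof of `P`, but in a list without repetitions equal entries have equal positions.
    enumeration⇒cardinality : ∀ {xs} → Unique xs → All P xs → (∀ {x} → P x → x ∈ xs) →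
                              HasCardinality (subsetoid S P) (length xs)
    enumeration⇒cardinality {xs} xs! Pxs complete = record
      { to        = λ (_ , px) → Any.index (complete px)
      ; cong      = λ {(_ , px)} {(_ , py)} x≈y → lookup-injective xs! _ _
          (trans (sym (lookup-index (complete px))) (trans x≈y (lookup-index (complete py))))
      ; bijective =
          (λ {(_ , px)} {(_ , py)} i≡j → trans (lookup-index (complete px))
            (trans (reflexive (cong (lookup xs) i≡j)) (sym (lookup-index (complete py)))))
        , λ i → (lookup xs i , All.lookup Pxs (∈-lookup i))
              , λ {(_ , pz)} z≈ → lookup-injective xs! _ _ (trans (sym (lookup-index (complete pz))) z≈)
      }

    -- Used for translations and for row and column swaps: mutually inverse maps of `S` that
    -- exchange `P` and `Q` preserve the count.
    subsetoid-transport : ∀ {q n} {Q : Carrier → Set q} (f g : Carrier → Carrier) →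
      (∀ {x y} → x ≈ y → f x ≈ f y) → (∀ {x y} → x ≈ y → g x ≈ g y) →
      (∀ x → f (g x) ≈ x) → (∀ x → g (f x) ≈ x) →
      (∀ {x} → P x → Q (f x)) → (∀ {x} → Q x → P (g x)) →
      HasCardinality (subsetoid S Q) n → HasCardinality (subsetoid S P) n
    subsetoid-transport {Q = Q} f g f-cong g-cong fg≈id gf≈id P⇒Q Q⇒P =
      Composition.bijection (Inverse⇒Bijection inverse)
      where
      inverse : Inverse (subsetoid S P) (subsetoid S Q)
      inverse = record
        { to        = λ (x , px) → f x , P⇒Q px
        ; from      = λ (x , qx) → g x , Q⇒P qx
        ; to-cong   = f-cong
        ; from-cong = g-cong
        ; inverse   = (λ y≈gx → trans (f-cong y≈gx) (fg≈id _))
                    , (λ y≈fx → trans (g-cong y≈fx) (gf≈id _))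
        }

-- Indicators and finite sums.

⟦_⟧ : ∀ {p} {P : Set p} → Dec P → ℕ
⟦ d ⟧ = if does d then 1 else 0

module _ {p} {P : Set p} where

  ⟦⟧-true : (d : Dec P) → P → ⟦ d ⟧ ≡ 1
  ⟦⟧-true d x = cong (if_then 1 else 0) (dec-true d x)

  ⟦⟧-false : (d : Dec P) → ¬ P → ⟦ d ⟧ ≡ 0
  ⟦⟧-false d ¬x = cong (if_then 1 else 0) (dec-false d ¬x)

  ⟦⟧-¬? : (d : Dec P) → ⟦ ¬? d ⟧ + ⟦ d ⟧ ≡ 1
  ⟦⟧-¬? (true  because _) = ≡.refl
  ⟦⟧-¬? (false because _) = ≡.refl

  module _ {q} {Q : Set q} where

    ⟦⟧-cong : (d : Dec P) (e : Dec Q) → (P → Q) → (Q → P) → ⟦ d ⟧ ≡ ⟦ e ⟧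
    ⟦⟧-cong d e P⇒Q Q⇒P = cong (if_then 1 else 0) (does-⇔ (mk⇔ P⇒Q Q⇒P) d e)

    -- Pointwise inclusion-exclusion for the complement of a union, with the negative terms moved
    -- across so that it stays in ℕ.
    ⟦⟧-inclusion-exclusion : (d : Dec P) (e : Dec Q) →
      ⟦ ¬? d ×-dec ¬? e ⟧ + (⟦ d ⟧ + ⟦ e ⟧) ≡ 1 + ⟦ d ×-dec e ⟧
    ⟦⟧-inclusion-exclusion (true  because _) (true  because _) = ≡.refl
    ⟦⟧-inclusion-exclusion (true  because _) (false because _) = ≡.refl
    ⟦⟧-inclusion-exclusion (false because _) (true  because _) = ≡.refl
    ⟦⟧-inclusion-exclusion (false because _) (false because _) = ≡.refl

⟦⟧-disjoint-⊎ : ∀ {p q r} {P : Set p} {Q : Set q} {R : Set r} (d : Dec P) (e : Dec Q) (f : Dec R) →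
  (R → P ⊎ Q) → (P → R) → (Q → R) → (P → ¬ Q) → ⟦ f ⟧ ≡ ⟦ d ⟧ + ⟦ e ⟧
⟦⟧-disjoint-⊎ (yes x) (yes y) f to P⇒R Q⇒R P⇒¬Q = contradiction y (P⇒¬Q x)
⟦⟧-disjoint-⊎ (yes x) (no _)  f to P⇒R Q⇒R P⇒¬Q = ⟦⟧-true f (P⇒R x)
⟦⟧-disjoint-⊎ (no _)  (yes y) f to P⇒R Q⇒R P⇒¬Q = ⟦⟧-true f (Q⇒R y)
⟦⟧-disjoint-⊎ (no ¬x) (no ¬y) f to P⇒R Q⇒R P⇒¬Q = ⟦⟧-false f ([ ¬x , ¬y ] ∘ to)

length-filter : ∀ {a p} {A : Set a} {P : A → Set p} (P? : ∀ x → Dec (P x)) xs →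
                length (List.filter P? xs) ≡ sumᴸ (List.map (λ x → ⟦ P? x ⟧) xs)
length-filter P? []       = ≡.refl
length-filter P? (x ∷ xs) with does (P? x)
... | true  = cong ℕ.suc (length-filter P? xs)
... | false = length-filter P? xs

sum-map-cartesianProductWith : ∀ {a b c} {A : Set a} {B : Set b} {C : Set c}
  (g : C → ℕ) (f : A → B → C) xs ys →
  sumᴸ (List.map g (List.cartesianProductWith f xs ys)) ≡
  sumᴸ (List.map (λ x → sumᴸ (List.map (λ y → g (f x y)) ys)) xs)
sum-map-cartesianProductWith g f []       ys = ≡.refl
sum-map-cartesianProductWith g f (x ∷ xs) ys = begin
  sumᴸ (List.map g (List.map (f x) ys List.++ rest))
    ≡⟨ cong sumᴸ (List.map-++ g (List.map (f x) ys) rest) ⟩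
  sumᴸ (List.map g (List.map (f x) ys) List.++ List.map g rest)
    ≡⟨ sum-++ (List.map g (List.map (f x) ys)) (List.map g rest) ⟩
  sumᴸ (List.map g (List.map (f x) ys)) + sumᴸ (List.map g rest)
    ≡⟨ ≡.cong₂ _+_ (cong sumᴸ (≡.sym (List.map-∘ ys))) (sum-map-cartesianProductWith g f xs ys) ⟩
  _ ∎
  where
  open ≡.≡-Reasoning
  rest = List.cartesianProductWith f xs ys

sum-tabulate : ∀ {n} (f : Fin n → ℕ) → sumᴸ (List.tabulate f) ≡ sum f
sum-tabulate {ℕ.zero}  f = ≡.refl
sum-tabulate {ℕ.suc n} f = ≡.cong₂ _+_ ≡.refl (sum-tabulate (f ∘ suc))

sum-singleton : ∀ {n} (f : Fin n → ℕ) i → f i ≡ 1 → (∀ j → j ≢ i → f j ≡ 0) → sum f ≡ 1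
sum-singleton {ℕ.suc n} f zero fi≡1 f≡0 = ≡.cong₂ _+_ fi≡1
  (≡.trans (sum-cong-≗ λ j → f≡0 (suc j) λ ()) (sum-replicate-zero n))
sum-singleton {ℕ.suc n} f (suc i) fi≡1 f≡0 = ≡.cong₂ _+_ (f≡0 zero λ ())
  (sum-singleton (f ∘ suc) i fi≡1 λ j j≢i → f≡0 (suc j) (j≢i ∘ Fin.suc-injective))

-- Every count is first proved as an equation between sums; truncated subtraction enters only
-- through this lemma.
m+o≡n⇒m≡n∸o : ∀ {m n o} → m + o ≡ n → m ≡ n ∸ o
m+o≡n⇒m≡n∸o {m} {n} {o} m+o≡n = ≡.trans (≡.sym (ℕ.m+n∸n≡m m o)) (cong (_∸ o) m+o≡n)

-- Finite fields: inverses and affine bijections.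

module FiniteField {ℓ₀ ℓ₁ ℓ₂} (F : HeytingField ℓ₀ ℓ₁ ℓ₂) {q : ℕ}
                   (card : HasCardinality (fieldSetoid F) q) where

  open CommutativeRing (fieldRing F) hiding (zero) renaming (_+_ to _+ᴿ_; _*_ to _*ᴿ_)
  open RingProperties ring using (x∙y⁻¹≈ε⇒x≈y; x≈y⇒x∙y⁻¹≈ε; -0#≈0#)
  open ℤ-Solver (fieldRing F)
  open Bijection card using (to; injective; surjective) renaming (cong to to-cong)

  from : Fin q → Carrier
  from i = proj₁ (surjective i)

  to-from : ∀ i → to (from i) ≡ i
  to-from i = proj₂ (surjective i) refl

  from-to : ∀ x → from (to x) ≈ x
  from-to x = injective (to-from (to x))

  from-injective : ∀ {i j} → from i ≈ from j → i ≡ j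
  from-injective {i} {j} eq = ≡.trans (≡.sym (to-from i)) (≡.trans (to-cong eq) (to-from j))

  infix 4 _≟_
  _≟_ : ∀ x y → Dec (x ≈ y)
  x ≟ y = map′ injective to-cong (to x Fin.≟ to y)

  x-0≈x : ∀ x → x - 0# ≈ x
  x-0≈x x = trans (+-congˡ -0#≈0#) (+-identityʳ x)

  -- The field axioms give inverses for elements apart from `0#`. A search through the finitely many
  -- elements either finds an inverse or shows that `x` is not apart from `0#`, and then tightness
  -- gives `x ≈ 0#`.
  inverse : ∀ {x} → x ≉ 0# → Σ Carrier λ y → x *ᴿ y ≈ 1#
  inverse {x} x≉0 with Fin.any? (λ i → x *ᴿ from i ≟ 1#)
  ... | yes (i , xy≈1) = from i , xy≈1
  ... | no ¬inverse = contradiction (proj₁ (HeytingField.tight F x 0#) ¬x#0) x≉0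
    where
    ¬x#0 : ¬ HeytingField._#_ F x 0#
    ¬x#0 x#0 =
      let y , _ , [x-0]y≈1 = HeytingField.#⇒invertible F x#0
      in ¬inverse (to y , trans (*-cong (sym (x-0≈x x)) (from-to y)) [x-0]y≈1)

  x*y≈0⇒y≈0 : ∀ {x y} → x ≉ 0# → x *ᴿ y ≈ 0# → y ≈ 0#
  x*y≈0⇒y≈0 {x} {y} x≉0 xy≈0 = begin
    y                  ≈⟨ *-identityˡ y ⟨
    1# *ᴿ y            ≈⟨ *-congʳ (proj₂ (inverse x≉0)) ⟨
    (x *ᴿ x⁻¹) *ᴿ y    ≈⟨ solve 3 (λ x x⁻¹ y → (x :* x⁻¹) :* y := x⁻¹ :* (x :* y)) refl x x⁻¹ y ⟩
    x⁻¹ *ᴿ (x *ᴿ y)    ≈⟨ *-congˡ xy≈0 ⟩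
    x⁻¹ *ᴿ 0#          ≈⟨ zeroʳ x⁻¹ ⟩
    0#                 ∎
    where
    open SetoidReasoning setoid
    x⁻¹ = proj₁ (inverse x≉0)

  -- The hyperbola and the singular matrices are counted after arbitrary bijective substitutions in
  -- the variables, so that one proof serves matrices, their translates and affine changes of
  -- variable.
  Bij : (Carrier → Carrier) → Set (ℓ₀ ⊔ ℓ₁)
  Bij = Bijective _≈_ _≈_

  id-bijective : Bij id
  id-bijective = id , λ y → y , id

  -‿bijective : ∀ {u} k → Bij u → Bij (λ x → u x - k)
  -‿bijective {u} k (u-inj , u-surj) =
      (λ {x} {y} eq → u-inj (trans (sym (cancel (u x))) (trans (+-congʳ eq) (cancel (u y)))))
    , λ y → let x , ux≈y+k = u-surj (y +ᴿ k) in
        x , λ z≈x → trans (+-congʳ (ux≈y+k z≈x)) (solve 2 (λ y k → y :+ k :- k := y) refl y k)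
    where
    cancel : ∀ x → (x - k) +ᴿ k ≈ x
    cancel x = solve 2 (λ x k → (x :- k) :+ k := x) refl x k

  *-bijective : ∀ {e u} → e ≉ 0# → Bij u → Bij (λ x → e *ᴿ u x)
  *-bijective {e} {u} e≉0 (u-inj , u-surj) =
      (λ {x} {y} eq → u-inj (x∙y⁻¹≈ε⇒x≈y _ _ (x*y≈0⇒y≈0 e≉0 (trans
        (solve 3 (λ e x y → e :* (x :- y) := e :* x :- e :* y) refl e (u x) (u y))
        (x≈y⇒x∙y⁻¹≈ε eq)))))
    , λ y → let x , ux≈ = u-surj (e⁻¹ *ᴿ y) in
        x , λ z≈x → trans (*-congˡ (ux≈ z≈x)) (trans (sym (*-assoc e e⁻¹ y))
          (trans (*-congʳ (proj₂ (inverse e≉0))) (*-identityˡ y)))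
    where e⁻¹ = proj₁ (inverse e≉0)

  -- Sums over the field; hyperbolas and singular matrices.

  opaque
    ∑ : (Carrier → ℕ) → ℕ
    ∑ f = sum (f ∘ from)

    ∑-cong : ∀ {f g} → (∀ x → f x ≡ g x) → ∑ f ≡ ∑ g
    ∑-cong f≗g = sum-cong-≗ (f≗g ∘ from)

    ∑-+ : ∀ f g → ∑ (λ x → f x + g x) ≡ ∑ f + ∑ g
    ∑-+ f g = ∑-distrib-+ (f ∘ from) (g ∘ from)

    ∑-const : ∀ k → ∑ (λ _ → k) ≡ q * k
    ∑-const k = sum-constant q
      where
      sum-constant : ∀ n → sum {n} (λ _ → k) ≡ n * k
      sum-constant ℕ.zero    = ≡.refl
      sum-constant (ℕ.suc n) = ≡.cong₂ _+_ ≡.refl (sum-constant n)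

    ∑-zero : ∀ {f} → (∀ x → f x ≡ 0) → ∑ f ≡ 0
    ∑-zero f≡0 = ≡.trans (∑-cong f≡0) (sum-replicate-zero q)

    ∑-swap : ∀ (f : Carrier → Carrier → ℕ) → ∑ (λ x → ∑ λ y → f x y) ≡ ∑ (λ y → ∑ λ x → f x y)
    ∑-swap f = ∑-comm (λ i j → f (from i) (from j))

    ∑-*ˡ : ∀ k f → ∑ (λ x → k * f x) ≡ k * ∑ f
    ∑-*ˡ k f = ≡.sym (*-distribˡ-sum k (f ∘ from))

    sum-tabulate-from : ∀ f → sumᴸ (List.map f (List.tabulate from)) ≡ ∑ f
    sum-tabulate-from f = ≡.trans (cong sumᴸ (List.map-tabulate from f)) (sum-tabulate (f ∘ from))

    -- The single solution is the preimage of `t`; all the counts below come down to this one.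
    ∑-solutions : ∀ {u} → Bij u → ∀ t → ∑ (λ x → ⟦ u x ≟ t ⟧) ≡ 1
    ∑-solutions {u} (u-inj , u-surj) t = let x₀ , ux₀≈t = u-surj t in
      sum-singleton _ (to x₀)
        (⟦⟧-true (u _ ≟ t) (ux₀≈t (from-to x₀)))
        λ j j≢ → ⟦⟧-false (u _ ≟ t) λ uj≈t → j≢ (≡.trans (≡.sym (to-from j))
          (to-cong (u-inj (trans uj≈t (sym (ux₀≈t refl))))))

  -- Carries a count through one more variable; `h` is a correction that would otherwise be
  -- subtracted.
  ∑-linear : ∀ {f g h} n k → (∀ x → f x + h x ≡ n + k * g x) → ∑ f + ∑ h ≡ q * n + k * ∑ g
  ∑-linear {f} {g} {h} n k eq = begin
    ∑ f + ∑ h                         ≡⟨ ∑-+ f h ⟨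
    ∑ (λ x → f x + h x)               ≡⟨ ∑-cong eq ⟩
    ∑ (λ x → n + k * g x)             ≡⟨ ∑-+ (λ _ → n) (λ x → k * g x) ⟩
    ∑ (λ _ → n) + ∑ (λ x → k * g x)   ≡⟨ ≡.cong₂ _+_ (∑-const n) (∑-*ˡ k g) ⟩
    q * n + k * ∑ g                   ∎
    where open ≡.≡-Reasoning

  -- If `u x` is nonzero, exactly one `y` fits. For the one `x` with `u x ≈ 0#`, all `q` values of
  -- `y` fit if `t ≈ 0#`, and none otherwise.
  ∑∑-hyperbola : ∀ {u v} → Bij u → Bij v → ∀ t →
    ∑ (λ x → ∑ λ y → ⟦ u x *ᴿ v y ≟ t ⟧) + 1 ≡ q + q * ⟦ t ≟ 0# ⟧
  ∑∑-hyperbola {u} {v} u-bij v-bij t = begin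
    -- The `1` is spread over the rows as the indicator of `u x ≈ 0#`, so that `row-count` is one
    -- formula for both kinds of row.
    ∑ row + 1                                ≡⟨ cong (λ w → ∑ row + w) (∑-solutions u-bij 0#) ⟨
    ∑ row + ∑ (λ x → ⟦ u x ≟ 0# ⟧)           ≡⟨ ∑-linear 1 k (λ x → row-count x (u x ≟ 0#)) ⟩
    q * 1 + k * ∑ (λ x → ⟦ u x ≟ 0# ⟧)       ≡⟨ cong (λ w → q * 1 + k * w) (∑-solutions u-bij 0#) ⟩
    q * 1 + k * 1                            ≡⟨ ≡.cong₂ _+_ (ℕ.*-identityʳ q) (ℕ.*-identityʳ k) ⟩
    q + k                                    ∎
    where
    open ≡.≡-Reasoning
    k = q * ⟦ t ≟ 0# ⟧
    row : Carrier → ℕ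
    row x = ∑ λ y → ⟦ u x *ᴿ v y ≟ t ⟧
    row-count : ∀ x (d : Dec (u x ≈ 0#)) → row x + ⟦ d ⟧ ≡ 1 + k * ⟦ d ⟧
    row-count x (yes ux≈0) = ≡.trans (ℕ.+-comm (row x) 1) (cong ℕ.suc (≡.trans
      (∑-cong λ y → ⟦⟧-cong (u x *ᴿ v y ≟ t) (t ≟ 0#)
        (λ eq → trans (sym eq) (trans (*-congʳ ux≈0) (zeroˡ _)))
        (λ t≈0 → trans (*-congʳ ux≈0) (trans (zeroˡ _) (sym t≈0))))
      (≡.trans (∑-const _) (≡.sym (ℕ.*-identityʳ k)))))
    row-count x (no ux≉0) = ≡.trans (ℕ.+-identityʳ (row x))
      (≡.trans (∑-solutions (*-bijective ux≉0 v-bij) t) (cong ℕ.suc (≡.sym (ℕ.*-zeroʳ k))))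

  -- For fixed `a` and `d` the points `b`, `c` form a hyperbola. It is degenerate when
  -- `u₁ a *ᴿ u₂ d` vanishes, and the pairs `a`, `d` for which this happens form a hyperbola again.
  ∑⁴-singular : ∀ {u₁ u₂ u₃ u₄} → Bij u₁ → Bij u₂ → Bij u₃ → Bij u₄ →
    ∑ (λ a → ∑ λ d → ∑ λ b → ∑ λ c → ⟦ u₁ a *ᴿ u₂ d - u₃ b *ᴿ u₄ c ≟ 0# ⟧) + q ≡ q ^ 3 + q ^ 2
  -- The cancelled `q * (q * 1)` collects the `+ 1` of `inner` over all `a` and `d`.
  ∑⁴-singular {u₁} {u₂} {u₃} {u₄} bij₁ bij₂ bij₃ bij₄ = ℕ.+-cancelʳ-≡ (q * (q * 1)) _ _ (begin
    ∑ f₁ + q + q * (q * 1)       ≡⟨ rearrange₁ (∑ f₁) q ⟩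
    (∑ f₁ + q * (q * 1)) + q     ≡⟨ cong (_+ q) outer ⟩
    q * (q * q) + q * ∑ z₁ + q   ≡⟨ rearrange₂ q (∑ z₁) ⟩
    q * (q * q) + q * (∑ z₁ + 1) ≡⟨ cong (λ w → q * (q * q) + q * w) (∑∑-hyperbola bij₁ bij₂ 0#) ⟩
    q * (q * q) + q * (q + q * ⟦ 0# ≟ 0# ⟧)
      ≡⟨ cong (λ w → q * (q * q) + q * (q + q * w)) (⟦⟧-true (0# ≟ 0#) refl) ⟩
    q * (q * q) + q * (q + q * 1) ≡⟨ rearrange₃ q ⟩
    q ^ 3 + q ^ 2 + q * (q * 1)  ∎)
    where
    open ≡.≡-Reasoning
    rearrange₁ : ∀ s q → s + q + q * (q * 1) ≡ s + q * (q * 1) + q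
    rearrange₁ = solve-∀
    rearrange₂ : ∀ q s → q * (q * q) + q * s + q ≡ q * (q * q) + q * (s + 1)
    rearrange₂ = solve-∀
    rearrange₃ : ∀ q → q * (q * q) + q * (q + q * 1) ≡ q * (q * (q * 1)) + q * (q * 1) + q * (q * 1)
    rearrange₃ = solve-∀

    f₂ z₂ : Carrier → Carrier → ℕ
    f₂ a d = ∑ λ b → ∑ λ c → ⟦ u₁ a *ᴿ u₂ d - u₃ b *ᴿ u₄ c ≟ 0# ⟧
    z₂ a d = ⟦ u₁ a *ᴿ u₂ d ≟ 0# ⟧
    f₁ z₁ : Carrier → ℕ
    f₁ a = ∑ λ d → f₂ a d
    z₁ a = ∑ λ d → z₂ a d

    inner : ∀ a d → f₂ a d + 1 ≡ q + q * z₂ a d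
    inner a d = ≡.trans
      (cong (_+ 1) (∑-cong λ b → ∑-cong λ c → ⟦⟧-cong (_ ≟ _) (_ ≟ _)
        (λ eq → sym (x∙y⁻¹≈ε⇒x≈y _ _ eq)) (λ eq → x≈y⇒x∙y⁻¹≈ε (sym eq))))
      (∑∑-hyperbola bij₃ bij₄ (u₁ a *ᴿ u₂ d))

    middle : ∀ a → f₁ a + q * 1 ≡ q * q + q * z₁ a
    middle a = ≡.trans (cong (λ w → f₁ a + w) (≡.sym (∑-const 1))) (∑-linear q q (inner a))

    outer : ∑ f₁ + q * (q * 1) ≡ q * (q * q) + q * ∑ z₁
    outer = ≡.trans (cong (λ w → ∑ f₁ + w) (≡.sym (∑-const (q * 1)))) (∑-linear (q * q) q middle)

  -- Pairs of singular matrices whose difference has a nonzero corner.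

  module _ {e} (e≉0 : e ≉ 0#) (f g h : Carrier) where

    private
      δ = e *ᴿ h - f *ᴿ g
      detZ detZ-D : (a b c d : Carrier) → Carrier
      detZ   a b c d = a *ᴿ d - b *ᴿ c
      detZ-D a b c d = (a - e) *ᴿ (d - h) - (b - f) *ᴿ (c - g)
      root : Carrier → Carrier
      root a = a *ᴿ δ *ᴿ (e - a)
      -- The value of `e *ᴿ d` at which the two determinants agree.
      k : (a b c : Carrier) → Carrier
      k a b c = δ - (h *ᴿ a - f *ᴿ c - g *ᴿ b)

    -- On det Z = 0 the equation det (Z - D) = 0 is linear in d with leading
    -- coefficient e; eliminating d from det Z = 0 leaves a hyperbola in b and c.
    ∑-both-singular : ∀ a b c →
      ∑ (λ d → ⟦ detZ a b c d ≟ 0# ×-dec detZ-D a b c d ≟ 0# ⟧) ≡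
      ⟦ (e *ᴿ b - f *ᴿ a) *ᴿ (e *ᴿ c - g *ᴿ a) ≟ root a ⟧
    ∑-both-singular a b c = by-cases (hyperbola ≟ root a)
      where
      open SetoidReasoning setoid
      hyperbola : Carrier
      hyperbola = (e *ᴿ b - f *ᴿ a) *ᴿ (e *ᴿ c - g *ᴿ a)

      difference : ∀ d → detZ-D a b c d ≈ detZ a b c d - (e *ᴿ d - k a b c)
      difference d = solve 8 (λ a b c d e f g h →
        (a :- e) :* (d :- h) :- (b :- f) :* (c :- g) :=
        (a :* d :- b :* c) :- (e :* d :- ((e :* h :- f :* g) :- (h :* a :- f :* c :- g :* b))))
        refl a b c d e f g h

      -- Inside the bracket `d` cancels; the outer factor `e` makes what remains factor as a product
      -- in `b` and `c`, up to a term in `a` alone.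
      elimination : ∀ d → e *ᴿ (e *ᴿ detZ a b c d - a *ᴿ (e *ᴿ d - k a b c)) ≈ root a - hyperbola
      elimination d = solve 8 (λ a b c d e f g h →
        e :* (e :* (a :* d :- b :* c)
           :- a :* (e :* d :- ((e :* h :- f :* g) :- (h :* a :- f :* c :- g :* b)))) :=
        a :* (e :* h :- f :* g) :* (e :- a) :- (e :* b :- f :* a) :* (e :* c :- g :* a))
        refl a b c d e f g h

      linear : ∀ d → detZ a b c d ≈ 0# → detZ-D a b c d ≈ 0# → e *ᴿ d - k a b c ≈ 0#
      linear d Z≈0 Z-D≈0 = begin
        e *ᴿ d - k a b c                                    ≈⟨ solve 2 (λ x y → y := x :- (x :- y)) refl _ _ ⟩
        detZ a b c d - (detZ a b c d - (e *ᴿ d - k a b c))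
          ≈⟨ x≈y⇒x∙y⁻¹≈ε (trans Z≈0 (trans (sym Z-D≈0) (difference d))) ⟩
        0#                                                  ∎

      both-singular⇒hyperbola : ∀ d → detZ a b c d ≈ 0# → detZ-D a b c d ≈ 0# → hyperbola ≈ root a
      both-singular⇒hyperbola d Z≈0 Z-D≈0 = sym (x∙y⁻¹≈ε⇒x≈y _ _ (begin
        root a - hyperbola                                            ≈⟨ elimination d ⟨
        e *ᴿ (e *ᴿ detZ a b c d - a *ᴿ (e *ᴿ d - k a b c))
          ≈⟨ *-congˡ (x≈y⇒x∙y⁻¹≈ε (trans (times-0 Z≈0) (sym (times-0 (linear d Z≈0 Z-D≈0))))) ⟩
        e *ᴿ 0#                                                 ≈⟨ zeroʳ e ⟩
        0#                                                      ∎))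
        where
        times-0 : ∀ {x y} → y ≈ 0# → x *ᴿ y ≈ 0#
        times-0 y≈0 = trans (*-congˡ y≈0) (zeroʳ _)

      hyperbola⇒both-singular : ∀ d → hyperbola ≈ root a → e *ᴿ d ≈ k a b c →
                          detZ a b c d ≈ 0# × detZ-D a b c d ≈ 0#
      hyperbola⇒both-singular d hyperbola≈root ed≈k = Z≈0 , trans (difference d) (x≈y⇒x∙y⁻¹≈ε (trans Z≈0 (sym ed-k≈0)))
        where
        ed-k≈0 : e *ᴿ d - k a b c ≈ 0#
        ed-k≈0 = x≈y⇒x∙y⁻¹≈ε ed≈k
        Z≈0 : detZ a b c d ≈ 0#
        -- The factor `e` is cancelled twice: first the outer one in `elimination`, then the one in
        -- front of `detZ`.
        Z≈0 = x*y≈0⇒y≈0 e≉0 (trans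
          (x∙y⁻¹≈ε⇒x≈y _ _ (x*y≈0⇒y≈0 e≉0 (trans (elimination d) (x≈y⇒x∙y⁻¹≈ε (sym hyperbola≈root)))))
          (trans (*-congˡ ed-k≈0) (zeroʳ a)))

      by-cases : (dec : Dec (hyperbola ≈ root a)) →
        ∑ (λ d → ⟦ detZ a b c d ≟ 0# ×-dec detZ-D a b c d ≟ 0# ⟧) ≡ ⟦ dec ⟧
      by-cases (yes hyperbola≈root) = ≡.trans
        (∑-cong λ d → ⟦⟧-cong (_ ≟ _ ×-dec _ ≟ _) (e *ᴿ d ≟ k a b c)
          (λ (Z≈0 , Z-D≈0) → x∙y⁻¹≈ε⇒x≈y _ _ (linear d Z≈0 Z-D≈0))
          (hyperbola⇒both-singular d hyperbola≈root))
        (∑-solutions (*-bijective e≉0 id-bijective) (k a b c))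
      by-cases (no hyperbola≉root) = ∑-zero λ d → ⟦⟧-false (_ ≟ _ ×-dec _ ≟ _)
        λ (Z≈0 , Z-D≈0) → hyperbola≉root (both-singular⇒hyperbola d Z≈0 Z-D≈0)

    ∑⁴-both-singular :
      ∑ (λ a → ∑ λ d → ∑ λ b → ∑ λ c → ⟦ detZ a b c d ≟ 0# ×-dec detZ-D a b c d ≟ 0# ⟧) + q ≡
      q * q + q * ∑ (λ a → ⟦ root a ≟ 0# ⟧)
    ∑⁴-both-singular = begin
      ∑ (λ a → ∑ λ d → ∑ λ b → ∑ λ c → X a b c d) + q
        -- The sum over `d`, the variable to be eliminated, is moved past those over `b` and `c` to
        -- the innermost place.
        ≡⟨ cong (_+ q) (∑-cong λ a → ≡.trans (∑-swap _)
             (∑-cong λ b → ≡.trans (∑-swap _) (∑-cong (∑-both-singular a b)))) ⟩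
      ∑ H + q
        ≡⟨ cong (λ w → ∑ H + w) (≡.trans (∑-const 1) (ℕ.*-identityʳ q)) ⟨
      ∑ H + ∑ (λ _ → 1)
        ≡⟨ ∑-linear q q (λ a → ∑∑-hyperbola
             (-‿bijective (f *ᴿ a) (*-bijective e≉0 id-bijective))
             (-‿bijective (g *ᴿ a) (*-bijective e≉0 id-bijective)) (root a)) ⟩
      q * q + q * ∑ (λ a → ⟦ root a ≟ 0# ⟧) ∎
      where
      open ≡.≡-Reasoning
      X : (a b c d : Carrier) → ℕ
      X a b c d = ⟦ detZ a b c d ≟ 0# ×-dec detZ-D a b c d ≟ 0# ⟧
      H : Carrier → ℕ
      H a = ∑ λ b → ∑ λ c → ⟦ (e *ᴿ b - f *ᴿ a) *ᴿ (e *ᴿ c - g *ᴿ a) ≟ root a ⟧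

    ∑-roots-singular : δ ≈ 0# → ∑ (λ a → ⟦ root a ≟ 0# ⟧) ≡ q
    ∑-roots-singular δ≈0 = ≡.trans
      (∑-cong λ a → ⟦⟧-true (root a ≟ 0#)
        (trans (*-congʳ (trans (*-congˡ δ≈0) (zeroʳ a))) (zeroˡ (e - a))))
      (≡.trans (∑-const 1) (ℕ.*-identityʳ q))

    -- The roots are `0#` and `e`; they differ because `e ≉ 0#`, so their indicators add up.
    ∑-roots-invertible : δ ≉ 0# → ∑ (λ a → ⟦ root a ≟ 0# ⟧) ≡ 2
    ∑-roots-invertible δ≉0 = begin
      ∑ (λ a → ⟦ root a ≟ 0# ⟧)                      ≡⟨ ∑-cong two-roots ⟩
      ∑ (λ a → ⟦ a ≟ 0# ⟧ + ⟦ a ≟ e ⟧)               ≡⟨ ∑-+ _ _ ⟩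
      ∑ (λ a → ⟦ a ≟ 0# ⟧) + ∑ (λ a → ⟦ a ≟ e ⟧)
        ≡⟨ ≡.cong₂ _+_ (∑-solutions id-bijective 0#) (∑-solutions id-bijective e) ⟩
      2                                              ∎
      where
      open ≡.≡-Reasoning
      root⇒ : ∀ a → Dec (a ≈ 0#) → root a ≈ 0# → a ≈ 0# ⊎ a ≈ e
      root⇒ a (yes a≈0) _      = inj₁ a≈0
      root⇒ a (no a≉0)  root≈0 = inj₂ (sym (x∙y⁻¹≈ε⇒x≈y e a
        (x*y≈0⇒y≈0 δ≉0 (x*y≈0⇒y≈0 a≉0 (trans (sym (*-assoc _ _ _)) root≈0)))))
      two-roots : ∀ a → ⟦ root a ≟ 0# ⟧ ≡ ⟦ a ≟ 0# ⟧ + ⟦ a ≟ e ⟧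
      two-roots a = ⟦⟧-disjoint-⊎ (a ≟ 0#) (a ≟ e) (root a ≟ 0#) (root⇒ a (a ≟ 0#))
        (λ a≈0 → trans (*-congʳ (trans (*-congʳ a≈0) (zeroˡ δ))) (zeroˡ (e - a)))
        (λ a≈e → trans (*-congˡ (x≈y⇒x∙y⁻¹≈ε (sym a≈e))) (zeroʳ _))
        (λ a≈0 a≈e → e≉0 (trans (sym a≈e) a≈0))

  -- Determinants and invertibility of matrices.

  infix 4 _≈ᴹ′_
  _≈ᴹ′_ : Mat F 2 → Mat F 2 → Set ℓ₁
  _≈ᴹ′_ = _≈ᴹ_ F

  infixl 6 _-′_
  _-′_ : Mat F 2 → Mat F 2 → Mat F 2
  _-′_ = _-ᴹ_ F

  det : Mat F 2 → Carrier
  det A = A 0F 0F *ᴿ A 1F 1F - A 0F 1F *ᴿ A 1F 0F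

  det-cong : ∀ {A B} → A ≈ᴹ′ B → det A ≈ det B
  det-cong A≈B = +-cong (*-cong (A≈B 0F 0F) (A≈B 1F 1F))
    (-‿cong (*-cong (A≈B 0F 1F) (A≈B 1F 0F)))

  -- A record instead of the bare inequality, so that `A` can be read off from the type of a proof.
  record Nonsingular (A : Mat F 2) : Set ℓ₁ where
    constructor nonsingular
    field det≉0 : det A ≉ 0#

  open Nonsingular

  nonsingular? : ∀ A → Dec (Nonsingular A)
  nonsingular? A = map′ nonsingular det≉0 (¬? (det A ≟ 0#))

  Nonsingular-resp : Nonsingular Respects _≈ᴹ′_
  Nonsingular-resp A≈B (nonsingular detA≉0) =
    nonsingular λ detB≈0 → detA≉0 (trans (det-cong A≈B) detB≈0)

  *ᴹ-entry : ∀ A B i j → _*ᴹ_ F {2} A B i j ≈ A i 0F *ᴿ B 0F j +ᴿ A i 1F *ᴿ B 1F j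
  *ᴹ-entry A B i j = +-congˡ (+-identityʳ _)

  1*1-0*0≈1 : 1# *ᴿ 1# - 0# *ᴿ 0# ≈ 1#
  1*1-0*0≈1 = trans (+-cong (*-identityˡ 1#) (-‿cong (zeroˡ 0#))) (x-0≈x 1#)

  -- By multiplicativity, `det X *ᴿ det A` is the determinant of `1ᴹ` for a left inverse `X`.
  GL⇒nonsingular : ∀ A → GL F A → Nonsingular A
  GL⇒nonsingular A (X , XA≈1 , _) = nonsingular λ det≈0 → 1≉0 F (begin
    1#                                      ≈⟨ 1*1-0*0≈1 ⟨
    1# *ᴿ 1# - 0# *ᴿ 0#
      ≈⟨ +-cong (*-cong (entry 0F 0F) (entry 1F 1F)) (-‿cong (*-cong (entry 0F 1F) (entry 1F 0F))) ⟨
    (x *ᴿ a +ᴿ y *ᴿ c) *ᴿ (z *ᴿ b +ᴿ w *ᴿ d) - (x *ᴿ b +ᴿ y *ᴿ d) *ᴿ (z *ᴿ a +ᴿ w *ᴿ c)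
      ≈⟨ solve 8 (λ a b c d x y z w →
           (x :* a :+ y :* c) :* (z :* b :+ w :* d) :- (x :* b :+ y :* d) :* (z :* a :+ w :* c) :=
           (x :* w :- y :* z) :* (a :* d :- b :* c)) refl a b c d x y z w ⟩
    det X *ᴿ det A                          ≈⟨ *-congˡ det≈0 ⟩
    det X *ᴿ 0#                             ≈⟨ zeroʳ (det X) ⟩
    0#                                      ∎)
    where
    open SetoidReasoning setoid
    a = A 0F 0F ; b = A 0F 1F ; c = A 1F 0F ; d = A 1F 1F
    x = X 0F 0F ; y = X 0F 1F ; z = X 1F 0F ; w = X 1F 1F
    entry : ∀ i j → X i 0F *ᴿ A 0F j +ᴿ X i 1F *ᴿ A 1F j ≈ 1ᴹ F i j
    entry i j = trans (sym (*ᴹ-entry X A i j)) (XA≈1 i j)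

  matrix : (a b c d : Carrier) → Mat F 2
  matrix a b c d 0F 0F = a
  matrix a b c d 0F 1F = b
  matrix a b c d 1F 0F = c
  matrix a b c d 1F 1F = d

  nonsingular⇒GL : ∀ {A} → Nonsingular A → GL F A
  nonsingular⇒GL {A} (nonsingular detA≉0) = X , XA≈1 , AX≈1
    where
    a = A 0F 0F ; b = A 0F 1F ; c = A 1F 0F ; d = A 1F 1F
    r = proj₁ (inverse detA≉0)
    X : Mat F 2
    -- The adjugate of `A`, scaled by the inverse `r` of the determinant.
    X = matrix (r *ᴿ d) (- (r *ᴿ b)) (- (r *ᴿ c)) (r *ᴿ a)
    det*r≈1 = proj₂ (inverse detA≉0)

    XA≈1 : _*ᴹ_ F X A ≈ᴹ′ 1ᴹ F
    XA≈1 0F 0F = trans (*ᴹ-entry X A 0F 0F) (trans (solve 5 (λ a b c d r →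
      (r :* d) :* a :+ (:- (r :* b)) :* c := (a :* d :- b :* c) :* r) refl a b c d r) det*r≈1)
    -- Zero is given to the solver as `r :- r`, an expression free of constants.
    XA≈1 0F 1F = trans (*ᴹ-entry X A 0F 1F) (trans (solve 3 (λ b d r →
      (r :* d) :* b :+ (:- (r :* b)) :* d := r :- r) refl b d r) (-‿inverseʳ r))
    XA≈1 1F 0F = trans (*ᴹ-entry X A 1F 0F) (trans (solve 3 (λ a c r →
      (:- (r :* c)) :* a :+ (r :* a) :* c := r :- r) refl a c r) (-‿inverseʳ r))
    XA≈1 1F 1F = trans (*ᴹ-entry X A 1F 1F) (trans (solve 5 (λ a b c d r →
      (:- (r :* c)) :* b :+ (r :* a) :* d := (a :* d :- b :* c) :* r) refl a b c d r) det*r≈1)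

    AX≈1 : _*ᴹ_ F A X ≈ᴹ′ 1ᴹ F
    AX≈1 0F 0F = trans (*ᴹ-entry A X 0F 0F) (trans (solve 5 (λ a b c d r →
      a :* (r :* d) :+ b :* (:- (r :* c)) := (a :* d :- b :* c) :* r) refl a b c d r) det*r≈1)
    AX≈1 0F 1F = trans (*ᴹ-entry A X 0F 1F) (trans (solve 3 (λ a b r →
      a :* (:- (r :* b)) :+ b :* (r :* a) := r :- r) refl a b r) (-‿inverseʳ r))
    AX≈1 1F 0F = trans (*ᴹ-entry A X 1F 0F) (trans (solve 3 (λ c d r →
      c :* (r :* d) :+ d :* (:- (r :* c)) := r :- r) refl c d r) (-‿inverseʳ r))
    AX≈1 1F 1F = trans (*ᴹ-entry A X 1F 1F) (trans (solve 5 (λ a b c d r →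
      c :* (:- (r :* b)) :+ d :* (r :* a) := (a :* d :- b :* c) :* r) refl a b c d r) det*r≈1)

  -- Enumeration of all matrices and sums over them.

  opaque
    -- The diagonal is outermost: once it is fixed, the singular matrices are the points of a
    -- hyperbola in the antidiagonal entries.
    ∑ᴹ : (Mat F 2 → ℕ) → ℕ
    ∑ᴹ f = ∑ λ a → ∑ λ d → ∑ λ b → ∑ λ c → f (matrix a b c d)

    ∑ᴹ-cong : ∀ {f g} → (∀ A → f A ≡ g A) → ∑ᴹ f ≡ ∑ᴹ g
    ∑ᴹ-cong f≗g = ∑-cong λ a → ∑-cong λ d → ∑-cong λ b → ∑-cong λ c → f≗g (matrix a b c d)

    ∑ᴹ-+ : ∀ f g → ∑ᴹ (λ A → f A + g A) ≡ ∑ᴹ f + ∑ᴹ g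
    ∑ᴹ-+ f g =
      ≡.trans (∑-cong λ a → ≡.trans (∑-cong λ d → ≡.trans (∑-cong λ b → ∑-+ _ _) (∑-+ _ _)) (∑-+ _ _)) (∑-+ _ _)

    ∑ᴹ-1 : ∑ᴹ (λ _ → 1) ≡ q ^ 4
    ∑ᴹ-1 =
      ≡.trans (∑-cong λ a → ≡.trans (∑-cong λ d → ≡.trans (∑-cong λ b → ∑-const 1) (∑-const _)) (∑-const _)) (∑-const _)

  elements : List Carrier
  elements = List.tabulate from

  ∈-elements : ∀ x → Membership._∈_ setoid x elements
  ∈-elements x = ∈-resp-≈ setoid (from-to x) (∈-tabulate⁺ setoid (to x))

  pairs : List (Carrier × Carrier)
  pairs = List.cartesianProduct elements elements

  -- Listed by diagonal and antidiagonal, in the order of summation of ∑ᴹ.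
  matrices : List (Mat F 2)
  matrices = List.cartesianProductWith (λ (a , d) (b , c) → matrix a b c d) pairs pairs

  matrices-unique : UniqueSetoid.Unique (matSetoid F 2) matrices
  matrices-unique = Unique.cartesianProductWith⁺ (setoid ×ₛ setoid) (setoid ×ₛ setoid) (matSetoid F 2) _
    (λ eq → (eq 0F 0F , eq 1F 1F) , (eq 0F 1F , eq 1F 0F)) pairs! pairs!
    where
    elements! : UniqueSetoid.Unique setoid elements
    elements! = Unique.tabulate⁺ setoid from-injective
    pairs! : UniqueSetoid.Unique (setoid ×ₛ setoid) pairs
    pairs! = Unique.cartesianProduct⁺ setoid setoid elements! elements!

  ∈-matrices : ∀ A → Membership._∈_ (matSetoid F 2) A matrices
  ∈-matrices A = ∈-resp-≈ (matSetoid F 2) entries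
    (∈-cartesianProductWith⁺ (setoid ×ₛ setoid) (setoid ×ₛ setoid) (matSetoid F 2)
      (λ { (a≈ , d≈) (b≈ , c≈) 0F 0F → a≈
         ; (a≈ , d≈) (b≈ , c≈) 0F 1F → b≈
         ; (a≈ , d≈) (b≈ , c≈) 1F 0F → c≈
         ; (a≈ , d≈) (b≈ , c≈) 1F 1F → d≈ })
      (∈-pairs (A 0F 0F) (A 1F 1F)) (∈-pairs (A 0F 1F) (A 1F 0F)))
    where
    ∈-pairs : ∀ x y → Membership._∈_ (setoid ×ₛ setoid) (x , y) pairs
    ∈-pairs x y = ∈-cartesianProduct⁺ setoid setoid (∈-elements x) (∈-elements y)
    entries : matrix (A 0F 0F) (A 0F 1F) (A 1F 0F) (A 1F 1F) ≈ᴹ′ A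
    entries 0F 0F = refl
    entries 0F 1F = refl
    entries 1F 0F = refl
    entries 1F 1F = refl

  sum-pairs : ∀ f → sumᴸ (List.map f pairs) ≡ ∑ λ x → ∑ λ y → f (x , y)
  sum-pairs f = ≡.trans (sum-map-cartesianProductWith f _,_ elements elements)
    (≡.trans (sum-tabulate-from _) (∑-cong λ x → sum-tabulate-from _))

  opaque
    unfolding ∑ᴹ

    sum-matrices : ∀ f → sumᴸ (List.map f matrices) ≡ ∑ᴹ f
    sum-matrices f = ≡.trans (sum-map-cartesianProductWith f _ pairs pairs)
      (≡.trans (sum-pairs _) (∑-cong λ a → ∑-cong λ d → sum-pairs _))

  -- The list of all matrices, filtered by `P?`, enumerates the subset, and its length is the sum of
  -- the indicators.
  decidable⇒cardinality : ∀ {p} {P : Mat F 2 → Set p} → P Respects _≈ᴹ′_ → (P? : ∀ A → Dec (P A)) →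
    HasCardinality (subsetoid (matSetoid F 2) P) (∑ᴹ (λ A → ⟦ P? A ⟧))
  decidable⇒cardinality {P = P} resp P? = ≡.subst (HasCardinality _)
    (≡.trans (length-filter P? matrices) (sum-matrices _))
    (enumeration⇒cardinality (matSetoid F 2)
      (Unique.filter⁺ (matSetoid F 2) P? matrices-unique)
      (All.all-filter P? matrices)
      (λ {A} pA → ∈-filter⁺ (matSetoid F 2) P? resp (∈-matrices A) pA))

  order-cardinality : HasCardinality (matSetoid F 2) (q ^ 4)
  order-cardinality = record
    { to        = λ A → Bijection.to all (A , tt)
    ; cong      = Bijection.cong all
    ; bijective = Bijection.injective all
                , λ i → let (A , _) , to≡i = Bijection.surjective all i in A , λ B≈A → to≡i B≈A
    }
    where
    all : HasCardinality (subsetoid (matSetoid F 2) (λ _ → ⊤)) (q ^ 4)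
    all = ≡.subst (HasCardinality _) ∑ᴹ-1 (decidable⇒cardinality (λ _ _ → tt) (λ _ → yes tt))

  -- Counts of nonsingular matrices and of nonsingular pairs.

  opaque
    unfolding ∑ᴹ

    ∑ᴹ-singular : ∑ᴹ (λ A → ⟦ det A ≟ 0# ⟧) + q ≡ q ^ 3 + q ^ 2
    ∑ᴹ-singular = ∑⁴-singular id-bijective id-bijective id-bijective id-bijective

    -- Translation by `D` acts on each entry as a bijection of the field.
    ∑ᴹ-singular-translate : ∀ D → ∑ᴹ (λ A → ⟦ det (A -′ D) ≟ 0# ⟧) + q ≡ q ^ 3 + q ^ 2
    ∑ᴹ-singular-translate D = ∑⁴-singular
      (-‿bijective (D 0F 0F) id-bijective) (-‿bijective (D 1F 1F) id-bijective)
      (-‿bijective (D 0F 1F) id-bijective) (-‿bijective (D 1F 0F) id-bijective)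

    ∑ᴹ-both-singular : ∀ D → D 0F 0F ≉ 0# →
      ∑ᴹ (λ A → ⟦ det A ≟ 0# ×-dec det (A -′ D) ≟ 0# ⟧) + q ≡
      q * q + q * ∑ (λ a → ⟦ a *ᴿ det D *ᴿ (D 0F 0F - a) ≟ 0# ⟧)
    ∑ᴹ-both-singular D D₀₀≉0 = ∑⁴-both-singular D₀₀≉0 (D 0F 1F) (D 1F 0F) (D 1F 1F)

  nonsingular-cardinality :
    HasCardinality (subsetoid (matSetoid F 2) Nonsingular) ((q ^ 4 + q) ∸ (q ^ 3 + q ^ 2))
  nonsingular-cardinality = ≡.subst (HasCardinality _) (m+o≡n⇒m≡n∸o count)
    (decidable⇒cardinality Nonsingular-resp nonsingular?)
    where
    open ≡.≡-Reasoning
    n s : ℕ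
    n = ∑ᴹ λ A → ⟦ nonsingular? A ⟧
    s = ∑ᴹ λ A → ⟦ det A ≟ 0# ⟧
    count : n + (q ^ 3 + q ^ 2) ≡ q ^ 4 + q
    count = begin
      n + (q ^ 3 + q ^ 2)   ≡⟨ cong (λ w → n + w) ∑ᴹ-singular ⟨
      n + (s + q)           ≡⟨ ℕ.+-assoc n s q ⟨
      n + s + q             ≡⟨ cong (_+ q) (∑ᴹ-+ _ _) ⟨
      ∑ᴹ (λ A → ⟦ nonsingular? A ⟧ + ⟦ det A ≟ 0# ⟧) + q
        -- `nonsingular?` is a negated decision under `map′`, which leaves `does` and hence the
        -- indicator unchanged.
        ≡⟨ cong (_+ q) (∑ᴹ-cong λ A → ⟦⟧-¬? (det A ≟ 0#)) ⟩
      ∑ᴹ (λ _ → 1) + q      ≡⟨ cong (_+ q) ∑ᴹ-1 ⟩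
      q ^ 4 + q             ∎

  NonsingularPair : Mat F 2 → Mat F 2 → Set ℓ₁
  NonsingularPair D A = Nonsingular A × Nonsingular (A -′ D)

  PairCardinality : Mat F 2 → ℕ → Set _
  PairCardinality D = HasCardinality (subsetoid (matSetoid F 2) (NonsingularPair D))

  module _ (D : Mat F 2) (D₀₀≉0 : D 0F 0F ≉ 0#) where

    private
      pair? : ∀ A → Dec (NonsingularPair D A)
      pair? A = nonsingular? A ×-dec nonsingular? (A -′ D)

      n s t m : ℕ
      n = ∑ᴹ λ A → ⟦ pair? A ⟧
      s = ∑ᴹ λ A → ⟦ det A ≟ 0# ⟧
      t = ∑ᴹ λ A → ⟦ det (A -′ D) ≟ 0# ⟧
      m = ∑ᴹ λ A → ⟦ det A ≟ 0# ×-dec det (A -′ D) ≟ 0# ⟧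

      cardinality : PairCardinality D n
      cardinality = decidable⇒cardinality
        (λ A≈B (detA≉0 , detA-D≉0) → Nonsingular-resp A≈B detA≉0
          , Nonsingular-resp (-ᴹ-cong F A≈B (≈ᴹ-refl F D)) detA-D≉0)
        pair?

      inclusion-exclusion : n + (s + t) ≡ q ^ 4 + m
      inclusion-exclusion = begin
        n + (s + t)      ≡⟨ cong (λ w → n + w) (∑ᴹ-+ _ _) ⟨
        n + ∑ᴹ (λ A → ⟦ det A ≟ 0# ⟧ + ⟦ det (A -′ D) ≟ 0# ⟧)      ≡⟨ ∑ᴹ-+ _ _ ⟨
        ∑ᴹ (λ A → ⟦ pair? A ⟧ + (⟦ det A ≟ 0# ⟧ + ⟦ det (A -′ D) ≟ 0# ⟧))
          ≡⟨ ∑ᴹ-cong (λ A → ⟦⟧-inclusion-exclusion (det A ≟ 0#) (det (A -′ D) ≟ 0#)) ⟩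
        ∑ᴹ (λ A → 1 + ⟦ det A ≟ 0# ×-dec det (A -′ D) ≟ 0# ⟧)      ≡⟨ ∑ᴹ-+ _ _ ⟩
        ∑ᴹ (λ _ → 1) + m ≡⟨ cong (_+ m) ∑ᴹ-1 ⟩
        q ^ 4 + m        ∎
        where open ≡.≡-Reasoning

      -- Here `r` is the number of degenerate hyperbolas. Of the two `q` that accompany the singular
      -- counts, one is absorbed into `m + q` and the other remains.
      count : ∀ {r} → m + q ≡ q * q + q * r →
              n + (q ^ 3 + q ^ 2 + (q ^ 3 + q ^ 2)) ≡ q ^ 4 + (q * q + q * r) + q
      count {r} m+q≡ = begin
        n + (q ^ 3 + q ^ 2 + (q ^ 3 + q ^ 2))
          ≡⟨ cong (λ w → n + w) (≡.cong₂ _+_ ∑ᴹ-singular (∑ᴹ-singular-translate D)) ⟨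
        n + ((s + q) + (t + q))                ≡⟨ regroup n s t q ⟩
        (n + (s + t)) + q + q                  ≡⟨ cong (λ w → w + q + q) inclusion-exclusion ⟩
        (q ^ 4 + m) + q + q                    ≡⟨ cong (_+ q) (ℕ.+-assoc (q ^ 4) m q) ⟩
        q ^ 4 + (m + q) + q                    ≡⟨ cong (λ w → q ^ 4 + w + q) m+q≡ ⟩
        q ^ 4 + (q * q + q * r) + q            ∎
        where
        open ≡.≡-Reasoning
        regroup : ∀ n s t q → n + ((s + q) + (t + q)) ≡ (n + (s + t)) + q + q
        regroup = solve-∀

      both = ∑ᴹ-both-singular D D₀₀≉0

    pair-cardinality-invertible : Nonsingular D →
      PairCardinality D ((q ^ 4 + 3 * q) ∸ (2 * q ^ 3 + q ^ 2))
    pair-cardinality-invertible (nonsingular detD≉0) = ≡.subst (PairCardinality D)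
      -- With two degenerate hyperbolas, `count` has `2 * q ^ 2` on the left and a single `q ^ 2` on
      -- the right, so one square is cancelled.
      (m+o≡n⇒m≡n∸o (ℕ.+-cancelʳ-≡ (q ^ 2) _ _ (≡.trans (lhs n (q ^ 3) (q ^ 2))
        (≡.trans (count {2} (≡.trans both (cong (λ r → q * q + q * r) roots))) (rhs (q ^ 4) q)))))
      cardinality
      where
      roots = ∑-roots-invertible D₀₀≉0 (D 0F 1F) (D 1F 0F) (D 1F 1F) detD≉0
      lhs : ∀ n x y → n + (2 * x + y) + y ≡ n + (x + y + (x + y))
      lhs = solve-∀
      rhs : ∀ x q → x + (q * q + q * 2) + q ≡ x + 3 * q + q * (q * 1)
      rhs = solve-∀

    pair-cardinality-singular : det D ≈ 0# → PairCardinality D ((q ^ 4 + q) ∸ 2 * q ^ 3)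
    pair-cardinality-singular detD≈0 = ≡.subst (PairCardinality D)
      -- With all `q` hyperbolas degenerate, both sides of `count` have `2 * q ^ 2`, and no square
      -- survives.
      (m+o≡n⇒m≡n∸o (ℕ.+-cancelʳ-≡ (2 * q ^ 2) _ _ (≡.trans (lhs n (q ^ 3) (q ^ 2))
        (≡.trans (count {q} (≡.trans both (cong (λ r → q * q + q * r) roots))) (rhs (q ^ 4) q)))))
      cardinality
      where
      roots = ∑-roots-singular D₀₀≉0 (D 0F 1F) (D 1F 0F) (D 1F 1F) detD≈0
      lhs : ∀ n x y → n + 2 * x + 2 * y ≡ n + (x + y + (x + y))
      lhs = solve-∀
      rhs : ∀ x q → x + (q * q + q * q) + q ≡ x + q + 2 * (q * (q * 1))
      rhs = solve-∀

  -- Moving a nonzero entry to the corner.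

  swap : Fin 2 → Fin 2 → Fin 2
  swap 0F k = k
  swap 1F k = Fin.opposite k

  swap-involutive : ∀ i k → swap i (swap i k) ≡ k
  swap-involutive 0F k = ≡.refl
  swap-involutive 1F k = Fin.opposite-involutive k

  -- `swap i` is the permutation of `Fin 2` that sends `0F` to `i`.
  pivot : Fin 2 → Fin 2 → Mat F 2 → Mat F 2
  pivot i j A k l = A (swap i k) (swap j l)

  pivot-entry : ∀ i j A → pivot i j A 0F 0F ≡ A i j
  pivot-entry 0F 0F A = ≡.refl
  pivot-entry 0F 1F A = ≡.refl
  pivot-entry 1F 0F A = ≡.refl
  pivot-entry 1F 1F A = ≡.refl

  pivot-involutive : ∀ i j A → pivot i j (pivot i j A) ≈ᴹ′ A
  pivot-involutive i j A k l = reflexive (≡.cong₂ A (swap-involutive i k) (swap-involutive j l))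

  -- A row swap or a column swap changes the sign of the determinant, and the two together restore
  -- it.
  pivot-singular : ∀ i j A → det A ≈ 0# → det (pivot i j A) ≈ 0#
  pivot-singular 0F 0F A detA≈0 = detA≈0
  pivot-singular 0F 1F A detA≈0 = trans
    (solve 4 (λ a b c d → b :* c :- a :* d := :- (a :* d :- b :* c)) refl
      (A 0F 0F) (A 0F 1F) (A 1F 0F) (A 1F 1F))
    (trans (-‿cong detA≈0) -0#≈0#)
  pivot-singular 1F 0F A detA≈0 = trans
    (solve 4 (λ a b c d → c :* b :- d :* a := :- (a :* d :- b :* c)) refl
      (A 0F 0F) (A 0F 1F) (A 1F 0F) (A 1F 1F))
    (trans (-‿cong detA≈0) -0#≈0#)
  pivot-singular 1F 1F A detA≈0 = trans
    (solve 4 (λ a b c d → d :* a :- c :* b := a :* d :- b :* c) refl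
      (A 0F 0F) (A 0F 1F) (A 1F 0F) (A 1F 1F))
    detA≈0

  -- The contrapositive of `pivot-singular` at the pivoted matrix, which a second pivot takes back
  -- to `A`.
  pivot-nonsingular : ∀ i j {A} → Nonsingular A → Nonsingular (pivot i j A)
  pivot-nonsingular i j {A} (nonsingular detA≉0) = nonsingular λ det≈0 → detA≉0
    (trans (sym (det-cong (pivot-involutive i j A))) (pivot-singular i j (pivot i j A) det≈0))

  -- `pivot i j` is its own inverse and commutes with subtraction by computation. On the way back,
  -- pivoting `D` twice gives `D` only up to `_≈ᴹ′_`, hence `Nonsingular-resp`.
  pivot-pair-cardinality : ∀ i j D {n} → PairCardinality (pivot i j D) n → PairCardinality D n
  pivot-pair-cardinality i j D = subsetoid-transport (matSetoid F 2) (pivot i j) (pivot i j)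
    (λ A≈B k l → A≈B (swap i k) (swap j l)) (λ A≈B k l → A≈B (swap i k) (swap j l))
    (pivot-involutive i j) (pivot-involutive i j)
    (λ (N , N-D) → pivot-nonsingular i j N , pivot-nonsingular i j N-D)
    (λ {A} (N , N-D) → pivot-nonsingular i j N
      , Nonsingular-resp (-ᴹ-cong F (≈ᴹ-refl F (pivot i j A)) (pivot-involutive i j D))
          (pivot-nonsingular i j N-D))

  -- Equality is decidable and the index set finite, so a failed universal statement yields a
  -- witness.
  nonzero-entry : ∀ (D : Mat F 2) → ¬ (∀ i j → D i j ≈ 0#) → Σ (Fin 2) λ i → Σ (Fin 2) λ j → D i j ≉ 0#
  nonzero-entry D D≉0 =
    let i , Dᵢ≉0 = Fin.¬∀⟶∃¬ 2 (λ i → ∀ j → D i j ≈ 0#) (λ i → Fin.all? λ j → D i j ≟ 0#) D≉0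
    in i , Fin.¬∀⟶∃¬ 2 (λ j → D i j ≈ 0#) (λ j → D i j ≟ 0#) Dᵢ≉0

  -- Translating neighbourhoods to the origin.

  module _ (x : Mat F 2) where

    translate-cong : ∀ {A B} → A ≈ᴹ′ B → A -′ x ≈ᴹ′ B -′ x
    translate-cong A≈B = -ᴹ-cong F A≈B (≈ᴹ-refl F x)

    infixl 6 _+x
    _+x : Mat F 2 → Mat F 2
    (A +x) i j = A i j +ᴿ x i j

    +x-cong : ∀ {A B} → A ≈ᴹ′ B → A +x ≈ᴹ′ B +x
    +x-cong A≈B i j = +-congʳ (A≈B i j)

    +x-x : ∀ A → A +x -′ x ≈ᴹ′ A
    +x-x A i j = solve 2 (λ a x → a :+ x :- x := a) refl (A i j) (x i j)

    -x+x : ∀ A → (A -′ x) +x ≈ᴹ′ A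
    -x+x A i j = solve 2 (λ a x → a :- x :+ x := a) refl (A i j) (x i j)

    neighbours-cardinality : ∀ {n} → HasCardinality (subsetoid (matSetoid F 2) Nonsingular) n →
      HasCardinality (SimpleGraph.neighbours (unitGraph F) x) n
    neighbours-cardinality = subsetoid-transport (matSetoid F 2) (_-′ x) _+x
      translate-cong +x-cong +x-x -x+x
      (GL⇒nonsingular _)
      (λ {A} N → nonsingular⇒GL (Nonsingular-resp (λ i j → sym (+x-x A i j)) N))

    -- Rests on the identity `z - y = (z - x) - (y - x)`, entry by entry.
    commonNeighbours-cardinality : ∀ y {n} → PairCardinality (y -′ x) n →
      HasCardinality (SimpleGraph.commonNeighbours (unitGraph F) x y) n
    commonNeighbours-cardinality y = subsetoid-transport (matSetoid F 2) (_-′ x) _+x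
      translate-cong +x-cong +x-x -x+x
      (λ {A} (gₓ , g_y) → GL⇒nonsingular _ gₓ , Nonsingular-resp
        (λ i j → solve 3 (λ a x y → a :- y := a :- x :- (y :- x)) refl (A i j) (x i j) (y i j))
        (GL⇒nonsingular (A -′ y) g_y))
      (λ {A} (Nₓ , N_y) → nonsingular⇒GL (Nonsingular-resp (λ i j → sym (+x-x A i j)) Nₓ)
        , nonsingular⇒GL (Nonsingular-resp
            (λ i j → solve 3 (λ a x y → a :- (y :- x) := a :+ x :- y) refl (A i j) (x i j) (y i j))
            N_y))

  module _ {x y} (x≉y : ¬ x ≈ᴹ′ y) where

    private
      D = y -′ x
      D≉0 = nonzero-entry D λ D≈0 → x≉y λ i j → sym (x∙y⁻¹≈ε⇒x≈y _ _ (D≈0 i j))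
      i = proj₁ D≉0
      j = proj₁ (proj₂ D≉0)

      corner≉0 : pivot i j D 0F 0F ≉ 0#
      corner≉0 = ≡.subst (_≉ 0#) (≡.sym (pivot-entry i j D)) (proj₂ (proj₂ D≉0))

    adjacent-cardinality : GL F D →
      HasCardinality (SimpleGraph.commonNeighbours (unitGraph F) x y)
        ((q ^ 4 + 3 * q) ∸ (2 * q ^ 3 + q ^ 2))
    adjacent-cardinality g = commonNeighbours-cardinality x y (pivot-pair-cardinality i j D
      (pair-cardinality-invertible (pivot i j D) corner≉0 (pivot-nonsingular i j (GL⇒nonsingular D g))))

    nonadjacent-cardinality : ¬ GL F D →
      HasCardinality (SimpleGraph.commonNeighbours (unitGraph F) x y) ((q ^ 4 + q) ∸ 2 * q ^ 3)
    nonadjacent-cardinality ¬g = commonNeighbours-cardinality x y (pivot-pair-cardinality i j D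
      (pair-cardinality-singular (pivot i j D) corner≉0
        -- Nonadjacency only refutes `det D ≉ 0#`; decidable equality removes the double negation.
        (pivot-singular i j D (decidable-stable (det D ≟ 0#) λ detD≉0 → ¬g (nonsingular⇒GL {D} (nonsingular detD≉0))))))

  -- An edge, a non-edge and the final assembly.

  0ᴹ : Mat F 2
  0ᴹ _ _ = 0#

  -0ᴹ : ∀ A → A -′ 0ᴹ ≈ᴹ′ A
  -0ᴹ A i j = x-0≈x (A i j)

  not-empty : ¬ SimpleGraph.Empty (unitGraph F)
  not-empty empty = empty 0ᴹ (1ᴹ F) (nonsingular⇒GL {1ᴹ F -′ 0ᴹ} (nonsingular λ det≈0 →
    1≉0 F (trans (sym 1*1-0*0≈1) (trans (sym (det-cong (-0ᴹ (1ᴹ F)))) det≈0))))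

  -- The matrix `E` of rank one is nonzero but singular, hence distinct from `0ᴹ` and not adjacent
  -- to it.
  not-complete : ¬ SimpleGraph.Complete (unitGraph F)
  not-complete complete = det≉0 (GL⇒nonsingular (E -′ 0ᴹ) (complete 0ᴹ E λ 0≈E → 1≉0 F (sym (0≈E 0F 0F))))
    (trans (det-cong (-0ᴹ E)) (x≈y⇒x∙y⁻¹≈ε (trans (zeroʳ 1#) (sym (zeroʳ 0#)))))
    where
    E = matrix 1# 0# 0# 0#

theorem3p5 : ∀ {c ℓ₁ ℓ₂} (F : HeytingField c ℓ₁ ℓ₂) (q : ℕ) →
    HasCardinality (fieldSetoid F) q →
    IsStronglyRegular (unitGraph F)
    (q ^ 4)
    ((q ^ 4 + q) ∸ (q ^ 3 + q ^ 2))
    ((q ^ 4 + 3 * q) ∸ (2 * q ^ 3 + q ^ 2))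
    ((q ^ 4 + q) ∸ 2 * q ^ 3)
theorem3p5 F q card = record
  { nonEmpty    = not-empty
  ; nonComplete = not-complete
  ; order       = order-cardinality
  ; regular     = λ x → neighbours-cardinality x nonsingular-cardinality
  ; adjacent    = λ x y x≉y → adjacent-cardinality x≉y
  ; nonadjacent = λ x y x≉y → nonadjacent-cardinality x≉y
  }
  where open FiniteField F card
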